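{- There is an algorithm that, given a finite poset $(P,>)$, finds a largest cut of $P$, i.e. a cut $(B,U)$ for which $e(B,U)$ is maximum among all cuts of $P$, in time linear in $|(P,>)|$.
   Context: $(P,>)$ is a finite partially ordered set with strict order relation. For subsets $X,Y\subseteq P$ (not necessarily disjoint), $e(X,Y):=|\{(x,y) : x\in X,\ y\in Y,\ x<y\}|$. A cut in $(P,>)$ is an ordered partition $(B,U)$ of the set $P$, i.e. $B\cup U=P$ and $B\cap U=\emptyset$ (a part may be empty); its size is $e(B,U)$. $|(P,>)|$ denotes the size of the input poset, given as the list of its elements together with the list of all pairs $x<y$, i.e. $|P|+e(P,P)$; running time is counted in elementary operations in the standard unit-cost RAM model. -}

module Defs where

open import Data.Bool.Base using (if_then_else_)
open import Data.Fin.Base using (Fin)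
open import Data.Fin.Subset using (Subset; _∪_; _∩_; ⊤; ⊥)
open import Data.Fin.Subset.Properties using (_∈?_)
open import Data.List.Base
  using (List; []; _∷_; _++_; [_]; map; concatMap; length; drop; head; filter; cartesianProduct; allFin)
open import Data.List.Membership.Propositional using (_∈_)
open import Data.List.Relation.Unary.Unique.Propositional using (Unique)
open import Data.Maybe.Base using (Maybe; just; nothing)
open import Data.Nat.Base using (ℕ; zero; suc; _+_; _∸_; _≤_)
open import Data.Nat.Properties using (_≟_)
open import Data.Product.Base using (_×_; _,_)
open import Data.Vec.Base using (toList)
open import Function.Bundles using (_⇔_)
open import Relation.Binary.Core using (Rel)
open import Relation.Binary.PropositionalEquality.Core using (_≡_)
open import Relation.Binary.Structures using (IsDecStrictPartialOrder)
open import Relation.Nullary.Decidable.Core using (does; _×-dec_)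
open import Level using (0ℓ)

-- Decidability of the order is automatic for an order that is given by the
-- list of its pairs; carrying it here allows e to be defined by counting.
record FinPoset : Set₁ where
  infix 4 _≺_
  field
    card                    : ℕ
    _≺_                     : Rel (Fin card) 0ℓ
    isDecStrictPartialOrder : IsDecStrictPartialOrder _≡_ _≺_

  open IsDecStrictPartialOrder isDecStrictPartialOrder public
    using () renaming (_<?_ to _≺?_)

module _ (P : FinPoset) where
  open FinPoset P

  e : Subset card → Subset card → ℕ
  e X Y = length (filter (λ (x , y) → (x ∈? X) ×-dec (y ∈? Y) ×-dec (x ≺? y))
                         (cartesianProduct (allFin card) (allFin card)))

  size : ℕ
  size = card + e ⊤ ⊤

  record IsCut (B U : Subset card) : Set where
    field
      covers   : B ∪ U ≡ ⊤
      disjoint : B ∩ U ≡ ⊥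

  record IsLargestCut (B U : Subset card) : Set where
    field
      isCut   : IsCut B U
      largest : ∀ B′ U′ → IsCut B′ U′ → e B′ U′ ≤ e B U

  -- The list ps contains every pair x ≺ y exactly once, in any order.
  record ListsOrder (ps : List (Fin card × Fin card)) : Set where
    field
      unique : Unique ps
      exact  : ∀ x y → (x , y) ∈ ps ⇔ x ≺ y

  -- Elements are known to the machine through arbitrary names.  The input is
  -- the list of (names of) elements followed by the list of pairs x ≺ y, each
  -- list being preceded by its length.
  encodeInput : (Fin card → ℕ) → List (Fin card × Fin card) → List ℕ
  encodeInput name ps =
    card ∷ map name (allFin card)
    ++ length ps ∷ concatMap (λ (x , y) → name x ∷ name y ∷ []) ps

  -- One number per element, in the order in which the input lists the
  -- elements: 1 for the elements of B, 0 for the others, which form U.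
  encodeCut : Subset card → List ℕ
  encodeCut B = map (λ b → if b then 1 else 0) (toList B)

-- The unit-cost RAM of Cook and Reckhow, with a read-only input tape, a
-- write-only output tape and registers X 0, X 1, … holding natural numbers (so
-- that subtraction is truncated).  There is no multiplication, and hence no
-- constant-time arithmetic on exponentially long numbers.
data Instr : Set where
  const     : (i c : ℕ)   → Instr   -- X i ← c
  add       : (i j k : ℕ) → Instr   -- X i ← X j + X k
  sub       : (i j k : ℕ) → Instr   -- X i ← X j ∸ X k
  loadInd   : (i j : ℕ)   → Instr   -- X i ← X (X j)
  storeInd  : (i j : ℕ)   → Instr   -- X (X i) ← X j
  jumpPos   : (m j : ℕ)   → Instr   -- go to instruction m if X j > 0
  readInto  : (i : ℕ)     → Instr   -- X i ← next number of the input
  print     : (i : ℕ)     → Instr   -- append X i to the output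
  halt      : Instr

Program : Set
Program = List Instr

Memory : Set
Memory = ℕ → ℕ

infixl 6 _[_≔_]
_[_≔_] : Memory → ℕ → ℕ → Memory
(X [ i ≔ v ]) j = if does (j ≟ i) then v else X j

record Config : Set where
  constructor config
  field
    pc     : ℕ
    mem    : Memory
    input  : List ℕ
    output : List ℕ

initial : List ℕ → Config
initial xs = config 0 (λ _ → 0) xs []

fetch : Program → ℕ → Maybe Instr
fetch p k = head (drop k p)

-- Reading past the end of the input is a failure, not a halt.
exec : Instr → Config → Maybe Config
exec (const i c)    (config pc X xs ys)       = just (config (suc pc) (X [ i ≔ c ]) xs ys)
exec (add i j k)    (config pc X xs ys)       = just (config (suc pc) (X [ i ≔ X j + X k ]) xs ys)
exec (sub i j k)    (config pc X xs ys)       = just (config (suc pc) (X [ i ≔ X j ∸ X k ]) xs ys)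
exec (loadInd i j)  (config pc X xs ys)       = just (config (suc pc) (X [ i ≔ X (X j) ]) xs ys)
exec (storeInd i j) (config pc X xs ys)       = just (config (suc pc) (X [ X i ≔ X j ]) xs ys)
exec (jumpPos m j)  (config pc X xs ys)  with X j
... | zero  = just (config (suc pc) X xs ys)
... | suc _ = just (config m X xs ys)
exec (readInto i)   (config pc X [] ys)       = nothing
exec (readInto i)   (config pc X (x ∷ xs) ys) = just (config (suc pc) (X [ i ≔ x ]) xs ys)
exec (print i)      (config pc X xs ys)       = just (config (suc pc) X xs (ys ++ [ X i ]))
exec halt           _                         = nothing

-- p ⊢ c ↝[ t ] ys: started in c, the program p executes exactly t instructions,
-- the last of which is halt, and its output tape then contains ys.
data _⊢_↝[_]_ (p : Program) : Config → ℕ → List ℕ → Set where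
  stop : ∀ {c} → fetch p (Config.pc c) ≡ just halt → p ⊢ c ↝[ 1 ] Config.output c
  step : ∀ {c c′ i t ys} → fetch p (Config.pc c) ≡ just i → exec i c ≡ just c′ →
         p ⊢ c′ ↝[ t ] ys → p ⊢ c ↝[ suc t ] ys

{-# OPTIONS --safe #-}

-- Let up x and down x be the numbers of elements above and below x.  If x ≺ y
-- with x in the upper and y in the lower part of a cut, then exchanging x and y
-- strictly enlarges the cut, so only cuts whose lower part B is a down-set
-- matter.  For those no pair goes from U to B, hence
-- e(B,U) = e(B,P) − e(P,B) = Σ_{x ∈ B} (up x − down x),
-- which is largest when B = {x : down x < up x}; and this B is a down-set.
-- A RAM computes up and down in one pass over the list of pairs, using the
-- names of the elements as addresses.
module Submission where

import Algebra.Properties.Semiring.Sum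
open import Data.Bool.Base using (Bool; true; false; T; if_then_else_; _∧_; _∨_; not)
open import Data.Bool.Properties using () renaming (_≟_ to _≟ᵇ_)
open import Data.Fin.Base using (Fin; zero; suc)
open import Data.Fin.Properties using (any?) renaming (_≟_ to _≟ᶠ_)
open import Data.Fin.Subset using (Subset; ⊤)
open import Data.Fin.Subset.Properties using (_∈?_)
open import Data.List.Base
  using (List; []; _∷_; _++_; [_]; map; concatMap; length; filter; cartesianProduct; allFin; tabulate)
open import Data.List.Membership.Propositional.Properties
  using (∈-filter⁺; ∈-filter⁻; ∈-cartesianProduct⁺; ∈-allFin)
open import Data.List.Membership.Propositional.Properties.WithK using (unique∧set⇒bag)
open import Data.List.Properties
  using (++-assoc; ++-identityʳ; length-map; length-tabulate; map-++; map-cong; map-tabulate; map-∘)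
open import Data.List.Relation.Binary.BagAndSetEquality using (∼bag⇒↭)
open import Data.List.Relation.Binary.Permutation.Propositional using (_↭_)
open import Data.List.Relation.Binary.Permutation.Propositional.Properties using (map⁺)
import Data.List.Relation.Unary.Unique.Propositional.Properties as Unique
open import Data.Maybe.Base using (Maybe; just; _>>=_)
open import Data.Nat.Base using (ℕ; zero; suc; _+_; _*_; _∸_; _≤_; _<_; _<ᵇ_; z≤n)
open import Data.Nat.DivMod using (_%_; [m+kn]%n≡m%n)
open import Data.Nat.ListAction using (sum)
open import Data.Nat.ListAction.Properties using (sum-++; sum-↭)
open import Data.Nat.Properties
open import Data.Nat.Tactic.RingSolver using (solve-∀)
open import Data.Product.Base using (_×_; _,_; ∃-syntax; proj₁; proj₂)
import Data.Vec.Base as Vec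
import Data.Vec.Properties as Vec
open import Function.Base using (_∘_; id)
open import Function.Bundles using (mk⇔; Equivalence)
open import Function.Definitions using (Injective)
open import Relation.Binary.PropositionalEquality hiding ([_])
open import Relation.Binary.Structures using (IsDecStrictPartialOrder)
open import Relation.Nullary.Decidable using (does; yes; no; dec-true; dec-false; _×-dec_)
open import Relation.Nullary.Negation using (contradiction; ¬_)
open import Relation.Unary using (Decidable)
open import Defs

open Algebra.Properties.Semiring.Sum +-*-semiring
  using (sum-cong-≗; ∑-distrib-+; ∑-comm; sum-replicate-zero; *-distribˡ-sum)
  renaming (sum to ∑)

⟦_⟧ : Bool → ℕ
⟦ b ⟧ = if b then 1 else 0

-- Executions

runs : Program → ℕ → Config → Maybe Config
runs p zero    c = just c
runs p (suc n) c = fetch p (Config.pc c) >>= λ i → exec i c >>= runs p n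

-- The relation `_⊢_↝[_]_` describes only complete runs that end in `halt`. A partial run is
-- therefore encoded by its effect on continuations: it extends every halting run from `c′` by `n`
-- steps.
record _⊢_⟶[_]_ (p : Program) (c : Config) (n : ℕ) (c′ : Config) : Set where
  constructor prepending
  field prepend : ∀ {t ys} → p ⊢ c′ ↝[ t ] ys → p ⊢ c ↝[ n + t ] ys
open _⊢_⟶[_]_

-- Lets evaluation do the work: a block without undetermined jumps is executed by `refl` in `runs`,
-- and this lemma turns the result into a derivation.
runs-sound : ∀ p n {c c′} → runs p n c ≡ just c′ → p ⊢ c ⟶[ n ] c′
runs-sound p zero    refl = prepending (λ r → r)
runs-sound p (suc n) {c} eq with fetch p (Config.pc c) in fetched
... | just i with exec i c in executed
...   | just c″ = prepending λ r → step fetched executed (prepend (runs-sound p n eq) r)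

⟶-trans : ∀ {p c c′ c″ m n} → p ⊢ c ⟶[ m ] c′ → p ⊢ c′ ⟶[ n ] c″ → p ⊢ c ⟶[ m + n ] c″
⟶-trans {p} {c} {m = m} {n} r s = prepending λ {t} {ys} u →
  subst (λ k → p ⊢ c ↝[ k ] ys) (sym (+-assoc m n t)) (prepend r (prepend s u))

-- Evaluation of `runs` is stuck at a jump on a register of unknown content, so the two outcomes of
-- a loop test need lemmas of their own. The jumps on `one` that close the loop bodies do evaluate,
-- since `one` has just been set to 1.
jump-taken : ∀ p {pc m j k X xs ys} → fetch p pc ≡ just (jumpPos m j) → X j ≡ suc k →
             p ⊢ config pc X xs ys ⟶[ 1 ] config m X xs ys
jump-taken p {pc} {m} {j} {k} {X} {xs} {ys} fetched pos = prepending (step fetched taken)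
  where
  taken : exec (jumpPos m j) (config pc X xs ys) ≡ just (config m X xs ys)
  taken rewrite pos = refl

jump-passed : ∀ p {pc m j X xs ys} → fetch p pc ≡ just (jumpPos m j) → X j ≡ 0 →
              p ⊢ config pc X xs ys ⟶[ 1 ] config (suc pc) X xs ys
jump-passed p {pc} {m} {j} {X} {xs} {ys} fetched null = prepending (step fetched passed)
  where
  passed : exec (jumpPos m j) (config pc X xs ys) ≡ just (config (suc pc) X xs ys)
  passed rewrite null = refl

-- The machine

-- The machine cannot multiply. Two additions produce exactly this term, so addresses agree by
-- computation.
thrice : ℕ → ℕ
thrice v = v + v + v

thrice≡*3 : ∀ v → thrice v ≡ v * 3
thrice≡*3 = unfolded
  where
  unfolded : ∀ v → v + v + v ≡ v * 3
  unfolded = solve-∀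

thrice-injective : ∀ {v w} → thrice v ≡ thrice w → v ≡ w
thrice-injective {v} {w} eq =
  *-cancelʳ-≡ v w 3 (trans (sym (thrice≡*3 v)) (trans eq (thrice≡*3 w)))

residue : ∀ r v → (r + thrice v) % 3 ≡ r % 3
residue r v = trans (cong (λ k → (r + k) % 3) (thrice≡*3 v)) ([m+kn]%n≡m%n r v 3)

-- Keeps the three arrays apart: their offsets 10, 11 and 12 differ modulo 3.
different-residues : ∀ r s v w → r % 3 ≢ s % 3 → r + thrice v ≢ s + thrice w
different-residues r s v w r≢s eq =
  r≢s (trans (sym (residue r v)) (trans (cong (_% 3) eq) (residue s w)))

-- Three interleaved arrays above the registers 0, …, 9, so that names may be
-- arbitrary numbers.
upCell downCell nameCell : ℕ → ℕ
upCell   v = 10 + thrice v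
downCell v = 11 + thrice v
nameCell k = 12 + thrice k

upCell-injective : ∀ v w → upCell v ≡ upCell w → v ≡ w
upCell-injective v w eq = thrice-injective (+-cancelˡ-≡ 10 (thrice v) (thrice w) eq)

downCell-injective : ∀ v w → downCell v ≡ downCell w → v ≡ w
downCell-injective v w eq = thrice-injective (+-cancelˡ-≡ 11 (thrice v) (thrice w) eq)

lookup-updated : ∀ X i v → (X [ i ≔ v ]) i ≡ v
lookup-updated X i v rewrite dec-true (i ≟ i) refl = refl

lookup-other : ∀ X {i v j} → j ≢ i → (X [ i ≔ v ]) j ≡ X j
lookup-other X {i} {v} {j} j≢i rewrite dec-false (j ≟ i) j≢i = refl

counter one value address base tally₁ tally₂ total : ℕ
counter = 0
one     = 1
value   = 2
address = 3
base    = 4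
tally₁  = 5
tally₂  = 6
total   = 7

-- The positions in prog of the tests and of the bodies of its three loops.
testNames testPairs testBits storeName countPair printBit : ℕ
testNames = 3
testPairs = 5
testBits  = 8
storeName = 10
countPair = 19
printBit  = 39

skeleton : Program
skeleton =
    readInto counter
  ∷ const base 0
  ∷ add total base counter
  ∷ jumpPos storeName counter
  ∷ readInto counter
  ∷ jumpPos countPair counter
  ∷ const base 0
  ∷ add counter base total
  ∷ jumpPos printBit counter
  ∷ halt
  ∷ []

-- The counter runs downwards and also serves as the index of the stored name.
storeNameBody : Program
storeNameBody =
    readInto value
  ∷ add address counter counter
  ∷ add address address counter
  ∷ const base 12
  ∷ add address base address
  ∷ storeInd address value
  ∷ const one 1
  ∷ sub counter counter one
  ∷ jumpPos testNames one
  ∷ []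

incrementCell : ℕ → Program
incrementCell offset =
    readInto value
  ∷ add address value value
  ∷ add address address value
  ∷ const base offset
  ∷ add address base address
  ∷ loadInd tally₁ address
  ∷ const one 1
  ∷ add tally₁ one tally₁
  ∷ storeInd address tally₁
  ∷ []

-- A pair `x ≺ y` gives `x` one more element above it and `y` one more below it, so the first name
-- selects an up-cell (offset 10) and the second a down-cell (offset 11).
countPairBody : Program
countPairBody =
  incrementCell 10 ++ incrementCell 11 ++ sub counter counter one ∷ jumpPos testPairs one ∷ []

-- The counter again runs down from the number of elements, so the stored names come back in the
-- order in which they were read.
printBitBody : Program
printBitBody =
    add address counter counter
  ∷ add address address counter
  ∷ const base 12
  ∷ add address base address
  ∷ loadInd value address
  ∷ add address value value
  ∷ add address address value
  ∷ const base 10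
  ∷ add base base address
  ∷ loadInd tally₁ base
  ∷ const base 11
  ∷ add base base address
  ∷ loadInd tally₂ base
  ∷ sub tally₁ tally₁ tally₂
  ∷ const one 1
  ∷ sub tally₁ one tally₁
  ∷ sub tally₁ one tally₁
  ∷ print tally₁
  ∷ sub counter counter one
  ∷ jumpPos testBits one
  ∷ []

prog : Program
prog = skeleton ++ storeNameBody ++ countPairBody ++ printBitBody

-- The truncated difference is positive exactly when `d < u`; subtracting twice from 1 reduces a
-- positive number to 1 and keeps 0.
bit : ℕ → ℕ → ℕ
bit u d = 1 ∸ (1 ∸ (u ∸ d))

infix 4 _≈_
-- Compares only the arrays and ignores the working registers. With addresses of the form `10 + k`,
-- comparisons with the registers 0 to 9 reduce.
_≈_ : Memory → Memory → Set
X ≈ Y = ∀ k → X (10 + k) ≡ Y (10 + k)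

-- In each of the following lemmas refl runs a block of code symbolically and
-- thereby finds the final memory.  The blocks are short because the term for the
-- memory grows threefold with every arithmetic instruction.

startNames : ∀ n xs → ∃[ X ]
    runs prog 3 (initial (n ∷ xs)) ≡ just (config testNames X xs [])
  × X counter ≡ n × X total ≡ n × X ≈ (λ _ → 0)
startNames n xs = _ , refl , refl , refl , λ _ → refl

startPairs : ∀ X m xs ys → ∃[ X′ ]
    runs prog 1 (config (suc testNames) X (m ∷ xs) ys) ≡ just (config testPairs X′ xs ys)
  × X′ counter ≡ m × X′ total ≡ X total × X′ ≈ X
startPairs X m xs ys = _ , refl , refl , refl , λ _ → refl

startBits : ∀ X xs ys → ∃[ X′ ]
    runs prog 2 (config (suc testPairs) X xs ys) ≡ just (config testBits X′ xs ys)
  × X′ counter ≡ X total × X′ ≈ X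
startBits X xs ys = _ , refl , refl , λ _ → refl

storeName-runs : ∀ X v xs ys → ∃[ X′ ]
    runs prog 9 (config storeName X (v ∷ xs) ys) ≡ just (config testNames X′ xs ys)
  × X′ counter ≡ X counter ∸ 1 × X′ total ≡ X total
  × X′ ≈ X [ nameCell (X counter) ≔ v ]
storeName-runs X v xs ys = _ , refl , refl , refl , λ k → refl

countUp-runs : ∀ X v xs ys → ∃[ X′ ]
    runs prog 9 (config countPair X (v ∷ xs) ys) ≡ just (config (9 + countPair) X′ xs ys)
  × X′ counter ≡ X counter × X′ total ≡ X total
  × X′ ≈ X [ upCell v ≔ suc (X (upCell v)) ]
countUp-runs X v xs ys = _ , refl , refl , refl , λ k → refl

countDown-runs : ∀ X v xs ys → ∃[ X′ ]
    runs prog 11 (config (9 + countPair) X (v ∷ xs) ys) ≡ just (config testPairs X′ xs ys)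
  × X′ counter ≡ X counter ∸ 1 × X′ total ≡ X total
  × X′ ≈ X [ downCell v ≔ suc (X (downCell v)) ]
countDown-runs X v xs ys = _ , refl , refl , refl , λ k → refl

loadName-runs : ∀ X xs ys → let v = X (nameCell (X counter)) in ∃[ X′ ]
    runs prog 7 (config printBit X xs ys) ≡ just (config (7 + printBit) X′ xs ys)
  × X′ counter ≡ X counter × X′ address ≡ thrice v × X′ ≈ X
loadName-runs X xs ys = _ , refl , refl , refl , λ k → refl

printBit-runs : ∀ X xs ys →
  let u = X (10 + X address)
      d = X (11 + X address) in ∃[ X′ ]
    runs prog 13 (config (7 + printBit) X xs ys)
      ≡ just (config testBits X′ xs (ys ++ [ bit u d ]))
  × X′ counter ≡ X counter ∸ 1 × X′ ≈ X
printBit-runs X xs ys = _ , refl , refl , λ k → refl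

-- The index of a name is the number of names from it to the end of the list, which is the value of
-- the counter when that name is read.
data Stored (X : Memory) : List ℕ → Set where
  []  : Stored X []
  _∷_ : ∀ {v vs} → X (nameCell (suc (length vs))) ≡ v → Stored X vs → Stored X (v ∷ vs)

Stored-resp : ∀ {X Y} → (∀ k → Y (nameCell k) ≡ X (nameCell k)) → ∀ {vs} → Stored X vs → Stored Y vs
Stored-resp Y≡X []                       = []
Stored-resp Y≡X (_∷_ {vs = vs} eq stored) =
  trans (Y≡X (suc (length vs))) eq ∷ Stored-resp Y≡X stored

-- The clause on indices above `length vs` is the invariant that protects earlier names: the
-- remaining rounds write only to smaller indices. A round costs one test and nine instructions; the
-- final 1 is the failing test.
storeNames : ∀ vs X xs ys → X counter ≡ length vs → ∃[ X′ ]
    prog ⊢ config testNames X (vs ++ xs) ys ⟶[ length vs * 10 + 1 ] config (suc testNames) X′ xs ys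
  × X′ total ≡ X total
  × Stored X′ vs
  × (∀ k → length vs < k → X′ (nameCell k) ≡ X (nameCell k))
  × (∀ v → X′ (upCell v) ≡ X (upCell v))
  × (∀ v → X′ (downCell v) ≡ X (downCell v))
storeNames [] X xs ys done =
  X , jump-passed prog refl done , refl , [] , (λ _ _ → refl) , (λ _ → refl) , (λ _ → refl)
storeNames (v ∷ vs) X xs ys count
  with X₁ , run₁ , counter₁ , total₁ , cells₁ ← storeName-runs X v (vs ++ xs) ys
  with X₂ , run₂ , total₂ , stored₂ , above₂ , up₂ , down₂ ←
         storeNames vs X₁ xs ys (trans counter₁ (cong (_∸ 1) count))
  = X₂
  , ⟶-trans (jump-taken prog refl count) (⟶-trans (runs-sound prog 9 run₁) run₂)
  , trans total₂ total₁
  , trans (above₂ _ (n<1+n _)) new-name ∷ stored₂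
  , (λ k l<k → trans (above₂ k (<-trans (n<1+n _) l<k))
      (trans (cells₁ _) (lookup-other X (name-above k l<k))))
  , (λ w → trans (up₂ w) (trans (cells₁ _)
      (lookup-other X (different-residues 10 12 w (X counter) λ ()))))
  , (λ w → trans (down₂ w) (trans (cells₁ _)
      (lookup-other X (different-residues 11 12 w (X counter) λ ()))))
  where
  name-above : ∀ k → length (v ∷ vs) < k → nameCell k ≢ nameCell (X counter)
  name-above k l<k eq =
    <⇒≢ l<k (sym (trans (thrice-injective (+-cancelˡ-≡ 12 (thrice k) _ eq)) count))

  new-name : X₁ (nameCell (suc (length vs))) ≡ v
  new-name = trans (cong (X₁ ∘ nameCell) (sym count))
    (trans (cells₁ _) (lookup-updated X (nameCell (X counter)) v))

δ : ℕ → ℕ → ℕ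
δ v w = ⟦ does (v ≟ w) ⟧

δ-refl : ∀ v → δ v v ≡ 1
δ-refl v rewrite dec-true (v ≟ v) refl = refl

δ-≢ : ∀ v w → v ≢ w → δ v w ≡ 0
δ-≢ v w v≢w rewrite dec-false (v ≟ w) v≢w = refl

tally : ℕ → List ℕ → ℕ
tally v ws = sum (map (δ v) ws)

incremented : ∀ (cell : ℕ → ℕ) → (∀ v w → cell v ≡ cell w → v ≡ w) → ∀ X v w →
              (X [ cell w ≔ suc (X (cell w)) ]) (cell v) ≡ δ v w + X (cell v)
incremented cell injective X v w with v ≟ w
... | yes refl = trans (lookup-updated X (cell v) (suc (X (cell v))))
                   (cong (_+ X (cell v)) (sym (δ-refl v)))
... | no  v≢w  = trans (lookup-other X {cell w} {suc (X (cell w))} (v≢w ∘ injective v w))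
                   (cong (_+ X (cell v)) (sym (δ-≢ v w v≢w)))

-- A round costs one test, 7 instructions to fetch the name and 13 to print its bit. The final 2
-- counts the failing test and `halt`.
printBits : ∀ (u d : ℕ → ℕ) vs X xs ys → X counter ≡ length vs → Stored X vs →
            (∀ v → X (upCell v) ≡ u v) → (∀ v → X (downCell v) ≡ d v) →
            prog ⊢ config testBits X xs ys
                 ↝[ length vs * 21 + 2 ] (ys ++ map (λ v → bit (u v) (d v)) vs)
printBits u d [] X xs ys done [] _ _ =
  subst (prog ⊢ config testBits X xs ys ↝[ 2 ]_) (sym (++-identityʳ ys))
    (prepend (jump-passed prog refl done) (stop refl))
printBits u d (v ∷ vs) X xs ys count (first ∷ stored) up down
  with X₁ , run₁ , counter₁ , address₁ , cells₁ ← loadName-runs X xs ys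
  with X₂ , run₂ , counter₂ , cells₂ ← printBit-runs X₁ xs ys
  = subst (prog ⊢ config testBits X xs ys ↝[ suc (length vs) * 21 + 2 ]_) outputs
      (prepend (⟶-trans (jump-taken prog refl count)
                 (⟶-trans (runs-sound prog 7 run₁) (runs-sound prog 13 run₂)))
        (printBits u d vs X₂ xs _
          (trans counter₂ (trans (cong (_∸ 1) counter₁) (cong (_∸ 1) count)))
          (Stored-resp (λ k → unchanged _) stored)
          (λ w → trans (unchanged _) (up w))
          (λ w → trans (unchanged _) (down w))))
  where
  unchanged : X₂ ≈ X
  unchanged k = trans (cells₂ k) (cells₁ k)

  address-of-v : X₁ address ≡ thrice v
  address-of-v = trans address₁
    (cong thrice (trans (cong (X ∘ nameCell) count) first))

  up-of-v : X₁ (10 + X₁ address) ≡ u v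
  up-of-v = trans (cells₁ _) (trans (cong (λ a → X (10 + a)) address-of-v) (up v))

  down-of-v : X₁ (11 + X₁ address) ≡ d v
  down-of-v = trans (cells₁ _) (trans (cong (λ a → X (11 + a)) address-of-v) (down v))

  rest : List ℕ
  rest = map (λ v → bit (u v) (d v)) vs

  outputs : (ys ++ [ bit (X₁ (10 + X₁ address)) (X₁ (11 + X₁ address)) ]) ++ rest
          ≡ ys ++ bit (u v) (d v) ∷ rest
  outputs = trans (++-assoc ys _ rest)
    (cong (λ b → ys ++ b ∷ rest) (cong₂ bit up-of-v down-of-v))

-- In order of execution: set-up, the loop over names, reading the number of pairs, the loop over
-- pairs, resetting the counter, and the printing loop with `halt`.
runtime : ℕ → ℕ → ℕ
runtime n m = 3 + (n * 10 + 1 + (1 + (m * 21 + 1 + (2 + (n * 21 + 2)))))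

module _ {A : Set} (name : A → ℕ) where

  encodePairs : List (A × A) → List ℕ
  encodePairs = concatMap λ (x , y) → name x ∷ name y ∷ []

  -- The initial contents of the tally cells are arbitrary, because in the induction the remaining
  -- pairs are counted on top of the earlier ones.
  countPairs : ∀ ps X ys → X counter ≡ length ps → ∃[ X′ ]
      prog ⊢ config testPairs X (encodePairs ps) ys
           ⟶[ length ps * 21 + 1 ] config (suc testPairs) X′ [] ys
    × X′ total ≡ X total
    × (∀ v → X′ (upCell v) ≡ tally v (map (name ∘ proj₁) ps) + X (upCell v))
    × (∀ v → X′ (downCell v) ≡ tally v (map (name ∘ proj₂) ps) + X (downCell v))
    × (∀ k → X′ (nameCell k) ≡ X (nameCell k))
  countPairs [] X ys done =
    X , jump-passed prog refl done , refl , (λ _ → refl) , (λ _ → refl) , (λ _ → refl)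
  countPairs ((x , y) ∷ ps) X ys count
    with X₁ , run₁ , counter₁ , total₁ , cells₁ ←
           countUp-runs X (name x) (name y ∷ encodePairs ps) ys
    with X₂ , run₂ , counter₂ , total₂ , cells₂ ←
           countDown-runs X₁ (name y) (encodePairs ps) ys
    with X₃ , run₃ , total₃ , up₃ , down₃ , names₃ ←
           countPairs ps X₂ ys
             (trans counter₂ (trans (cong (_∸ 1) counter₁) (cong (_∸ 1) count)))
    = X₃
    , ⟶-trans (jump-taken prog refl count)
        (⟶-trans (runs-sound prog 9 run₁) (⟶-trans (runs-sound prog 11 run₂) run₃))
    , trans total₃ (trans total₂ total₁)
    , (λ v → begin
        X₃ (upCell v)
          ≡⟨ up₃ v ⟩
        tally v (map (name ∘ proj₁) ps) + X₂ (upCell v)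
          ≡⟨ cong (tally v (map (name ∘ proj₁) ps) +_) (up₁₂ v) ⟩
        tally v (map (name ∘ proj₁) ps) + (δ v (name x) + X (upCell v))
          ≡⟨ shift (δ v (name x)) (tally v (map (name ∘ proj₁) ps)) (X (upCell v)) ⟩
        tally v (map (name ∘ proj₁) ((x , y) ∷ ps)) + X (upCell v) ∎)
    , (λ v → begin
        X₃ (downCell v)
          ≡⟨ down₃ v ⟩
        tally v (map (name ∘ proj₂) ps) + X₂ (downCell v)
          ≡⟨ cong (tally v (map (name ∘ proj₂) ps) +_) (down₁₂ v) ⟩
        tally v (map (name ∘ proj₂) ps) + (δ v (name y) + X (downCell v))
          ≡⟨ shift (δ v (name y)) (tally v (map (name ∘ proj₂) ps)) (X (downCell v)) ⟩
        tally v (map (name ∘ proj₂) ((x , y) ∷ ps)) + X (downCell v) ∎)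
    , (λ k → trans (names₃ k)
        (trans (cells₂ _) (trans (lookup-other X₁ (different-residues 12 11 k (name y) λ ()))
        (trans (cells₁ _) (lookup-other X (different-residues 12 10 k (name x) λ ()))))))
    where
    open ≡-Reasoning

    shift : ∀ a b c → b + (a + c) ≡ a + b + c
    shift = solve-∀

    up₁₂ : ∀ v → X₂ (upCell v) ≡ δ v (name x) + X (upCell v)
    up₁₂ v = trans (cells₂ _) (trans (lookup-other X₁ (different-residues 10 11 v (name y) λ ()))
      (trans (cells₁ _)
        (incremented upCell upCell-injective X v (name x))))

    down₁₂ : ∀ v → X₂ (downCell v) ≡ δ v (name y) + X (downCell v)
    down₁₂ v = trans (cells₂ _)
      (trans (incremented downCell downCell-injective X₁ v (name y))
        (cong (δ v (name y) +_)
          (trans (cells₁ _) (lookup-other X (different-residues 11 10 v (name x) λ ())))))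

  prog-runs : ∀ vs ps →
    prog ⊢ initial (length vs ∷ vs ++ length ps ∷ encodePairs ps)
         ↝[ runtime (length vs) (length ps) ]
         map (λ v → bit (tally v (map (name ∘ proj₁) ps)) (tally v (map (name ∘ proj₂) ps))) vs
  prog-runs vs ps
    with X₀ , run₀ , counter₀ , total₀ , cells₀ ← startNames (length vs) (vs ++ length ps ∷ encodePairs ps)
    with X₁ , run₁ , total₁ , stored₁ , _ , up₁ , down₁ ←
           storeNames vs X₀ (length ps ∷ encodePairs ps) [] counter₀
    with X₂ , run₂ , counter₂ , total₂ , cells₂ ← startPairs X₁ (length ps) (encodePairs ps) []
    with X₃ , run₃ , total₃ , up₃ , down₃ , names₃ ← countPairs ps X₂ [] counter₂
    with X₄ , run₄ , counter₄ , cells₄ ← startBits X₃ [] []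
    = prepend (runs-sound prog 3 run₀)
      (prepend run₁ (prepend (runs-sound prog 1 run₂) (prepend run₃
      (prepend (runs-sound prog 2 run₄)
        (printBits _ _ vs X₄ [] []
          (trans counter₄ (trans total₃ (trans total₂ (trans total₁ total₀))))
          (Stored-resp (λ k → trans (cells₄ _) (trans (names₃ k) (cells₂ _))) stored₁)
          -- The tallies start at 0: memory is initially zero, and storing the names does not touch
          -- these cells.
          (λ v → trans (cells₄ _) (trans (up₃ v) (vanishing
            (trans (cells₂ _) (trans (up₁ v) (cells₀ _))))))
          (λ v → trans (cells₄ _) (trans (down₃ v) (vanishing
            (trans (cells₂ _) (trans (down₁ v) (cells₀ _)))))))))))
    where
    vanishing : ∀ {a b} → b ≡ 0 → a + b ≡ a
    vanishing refl = +-identityʳ _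

-- Sums

⟦⟧-∧ : ∀ a b → ⟦ a ∧ b ⟧ ≡ ⟦ a ⟧ * ⟦ b ⟧
⟦⟧-∧ true  b = sym (*-identityˡ ⟦ b ⟧)
⟦⟧-∧ false b = refl

∑-mono : ∀ {n} {f g : Fin n → ℕ} → (∀ x → f x ≤ g x) → ∑ f ≤ ∑ g
∑-mono {zero}  f≤g = z≤n
∑-mono {suc n} f≤g = +-mono-≤ (f≤g zero) (∑-mono (f≤g ∘ suc))

δ′ : ∀ {n} → Fin n → Fin n → ℕ
δ′ x y = ⟦ does (x ≟ᶠ y) ⟧

∑-δ : ∀ {n} x (f : Fin n → ℕ) → ∑ (λ y → δ′ x y * f y) ≡ f x
∑-δ {suc n} zero    f = trans (cong₂ _+_ (*-identityˡ (f zero)) (sum-replicate-zero n))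
                              (+-identityʳ (f zero))
∑-δ {suc n} (suc x) f = ∑-δ x (f ∘ suc)

sum-filter : ∀ {A : Set} {Q : A → Set} (Q? : Decidable Q) (h : A → ℕ) xs →
             sum (map h (filter Q? xs)) ≡ sum (map (λ x → ⟦ does (Q? x) ⟧ * h x) xs)
sum-filter Q? h []       = refl
sum-filter Q? h (x ∷ xs) with does (Q? x)
... | true  = cong₂ _+_ (sym (*-identityˡ (h x))) (sum-filter Q? h xs)
... | false = sum-filter Q? h xs

length≡sum : ∀ {A : Set} (xs : List A) → length xs ≡ sum (map (λ _ → 1) xs)
length≡sum []       = refl
length≡sum (x ∷ xs) = cong suc (length≡sum xs)

sum-tabulate : ∀ {n} (f : Fin n → ℕ) → sum (tabulate f) ≡ ∑ f
sum-tabulate {zero}  f = refl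
sum-tabulate {suc n} f = cong (f zero +_) (sum-tabulate (f ∘ suc))

sum-allFin : ∀ n (f : Fin n → ℕ) → sum (map f (allFin n)) ≡ ∑ f
sum-allFin n f = trans (cong sum (map-tabulate id f)) (sum-tabulate f)

sum-cartesianProduct : ∀ {A B : Set} (h : A × B → ℕ) xs ys →
  sum (map h (cartesianProduct xs ys)) ≡ sum (map (λ x → sum (map (λ y → h (x , y)) ys)) xs)
sum-cartesianProduct h []       ys = refl
sum-cartesianProduct h (x ∷ xs) ys = begin
  sum (map h (map (x ,_) ys ++ cartesianProduct xs ys))
    ≡⟨ cong sum (map-++ h (map (x ,_) ys) _) ⟩
  sum (map h (map (x ,_) ys) ++ map h (cartesianProduct xs ys))
    ≡⟨ sum-++ (map h (map (x ,_) ys)) _ ⟩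
  sum (map h (map (x ,_) ys)) + sum (map h (cartesianProduct xs ys))
    ≡⟨ cong₂ _+_ (cong sum (sym (map-∘ ys))) (sum-cartesianProduct h xs ys) ⟩
  sum (map (λ x → sum (map (λ y → h (x , y)) ys)) (x ∷ xs)) ∎
  where open ≡-Reasoning

-- Passes from filtered lists of pairs, in terms of which `e` is defined, to double sums, where
-- order of summation and linearity are available.
sum-filter-pairs : ∀ {n} {Q : Fin n × Fin n → Set} (Q? : Decidable Q) h →
  sum (map h (filter Q? (cartesianProduct (allFin n) (allFin n))))
    ≡ ∑ λ x → ∑ λ y → ⟦ does (Q? (x , y)) ⟧ * h (x , y)
sum-filter-pairs {n} Q? h =
  trans (sum-filter Q? h (cartesianProduct (allFin n) (allFin n)))
  (trans (sum-cartesianProduct (λ p → ⟦ does (Q? p) ⟧ * h p) (allFin n) (allFin n))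
  (trans (sum-allFin n _) (sum-cong-≗ {n} λ x → sum-allFin n _)))

does-∈? : ∀ {n} x (X : Subset n) → does (x ∈? X) ≡ Vec.lookup X x
does-∈? zero    (true  Vec.∷ X) = refl
does-∈? zero    (false Vec.∷ X) = refl
does-∈? (suc x) (_     Vec.∷ X) = does-∈? x X

bit≡⟦<ᵇ⟧ : ∀ u d → bit u d ≡ ⟦ d <ᵇ u ⟧
bit≡⟦<ᵇ⟧ zero    zero    = refl
bit≡⟦<ᵇ⟧ zero    (suc d) = refl
bit≡⟦<ᵇ⟧ (suc u) zero    = cong (1 ∸_) (0∸n≡0 u)
bit≡⟦<ᵇ⟧ (suc u) (suc d) = bit≡⟦<ᵇ⟧ u d

toList-tabulate : ∀ {A : Set} {n} (f : Fin n → A) → Vec.toList (Vec.tabulate f) ≡ tabulate f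
toList-tabulate {n = zero}  f = refl
toList-tabulate {n = suc n} f = cong (f zero ∷_) (toList-tabulate (f ∘ suc))

-- Cuts

module _ (P : FinPoset) where
  open FinPoset P
  open IsDecStrictPartialOrder isDecStrictPartialOrder
    using () renaming (irrefl to ≺-irrefl; trans to ≺-trans; asym to ≺-asym)

  -- The order as a bilinear form

  ζ : Fin card → Fin card → ℕ
  ζ x y = ⟦ does (x ≺? y) ⟧

  ζ-yes : ∀ {x y} → x ≺ y → ζ x y ≡ 1
  ζ-yes {x} {y} x≺y = cong ⟦_⟧ (dec-true (x ≺? y) x≺y)

  ζ-no : ∀ {x y} → ¬ x ≺ y → ζ x y ≡ 0
  ζ-no {x} {y} x⊀y = cong ⟦_⟧ (dec-false (x ≺? y) x⊀y)

  ζ-≤ : ∀ x y x′ y′ → (x ≺ y → x′ ≺ y′) → ζ x y ≤ ζ x′ y′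
  ζ-≤ x y x′ y′ imp with x ≺? y
  ... | yes x≺y = ≤-reflexive (sym (ζ-yes (imp x≺y)))
  ... | no  _   = z≤n

  -- Subsets are generalised to weights so that `e` extends to the bilinear form `E`; moving a
  -- single element then means adding a `δ′`.
  Weight : Set
  Weight = Fin card → ℕ

  infixl 6 _⊕_
  _⊕_ : Weight → Weight → Weight
  (f ⊕ g) x = f x + g x

  𝟙 : Weight
  𝟙 _ = 1

  above below : Weight → Weight
  above g x = ∑ λ y → g y * ζ x y
  below f y = ∑ λ x → f x * ζ x y

  E : Weight → Weight → ℕ
  E f g = ∑ λ x → f x * above g x

  -- Groups the pairs by their upper instead of their lower end, which makes linearity in the second
  -- argument visible.
  E≡∑below : ∀ f g → E f g ≡ ∑ λ y → g y * below f y
  E≡∑below f g = begin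
    E f g                                   ≡⟨ sum-cong-≗ (λ x → *-distribˡ-sum (f x) λ y → g y * ζ x y) ⟩
    (∑ λ x → ∑ λ y → f x * (g y * ζ x y))   ≡⟨ ∑-comm (λ x y → f x * (g y * ζ x y)) ⟩
    (∑ λ y → ∑ λ x → f x * (g y * ζ x y))   ≡⟨ sum-cong-≗ (λ y → sum-cong-≗ λ x → exchange (f x) (g y) (ζ x y)) ⟩
    (∑ λ y → ∑ λ x → g y * (f x * ζ x y))   ≡⟨ sum-cong-≗ (λ y → *-distribˡ-sum (g y) λ x → f x * ζ x y) ⟨
    (∑ λ y → g y * below f y)               ∎
    where
    open ≡-Reasoning
    exchange : ∀ a b c → a * (b * c) ≡ b * (a * c)
    exchange = solve-∀

  E-mono : ∀ {f f′ g g′} → (∀ x → f x ≤ f′ x) → (∀ x → g x ≤ g′ x) → E f g ≤ E f′ g′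
  E-mono f≤f′ g≤g′ = ∑-mono λ x → *-mono-≤ (f≤f′ x) (∑-mono λ y → *-monoˡ-≤ (ζ x y) (g≤g′ y))

  E-cong : ∀ {f f′ g g′} → f ≗ f′ → g ≗ g′ → E f g ≡ E f′ g′
  E-cong f≗f′ g≗g′ =
    sum-cong-≗ λ x → cong₂ _*_ (f≗f′ x) (sum-cong-≗ λ y → cong (_* ζ x y) (g≗g′ y))

  E-⊕ˡ : ∀ f f′ g → E (f ⊕ f′) g ≡ E f g + E f′ g
  E-⊕ˡ f f′ g = trans (sum-cong-≗ λ x → *-distribʳ-+ (above g x) (f x) (f′ x))
                      (∑-distrib-+ (λ x → f x * above g x) (λ x → f′ x * above g x))

  E-⊕ʳ : ∀ f g g′ → E f (g ⊕ g′) ≡ E f g + E f g′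
  E-⊕ʳ f g g′ = begin
    E f (g ⊕ g′)                                      ≡⟨ E≡∑below f (g ⊕ g′) ⟩
    (∑ λ y → (g y + g′ y) * below f y)                ≡⟨ sum-cong-≗ (λ y → *-distribʳ-+ (below f y) (g y) (g′ y)) ⟩
    (∑ λ y → g y * below f y + g′ y * below f y)      ≡⟨ ∑-distrib-+ (λ y → g y * below f y) (λ y → g′ y * below f y) ⟩
    (∑ λ y → g y * below f y) + (∑ λ y → g′ y * below f y) ≡⟨ cong₂ _+_ (E≡∑below f g) (E≡∑below f g′) ⟨
    E f g + E f g′                                    ∎
    where open ≡-Reasoning

  E-δˡ : ∀ x g → E (δ′ x) g ≡ above g x
  E-δˡ x g = ∑-δ x (above g)

  E-δʳ : ∀ f y → E f (δ′ y) ≡ below f y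
  E-δʳ f y = trans (E≡∑below f (δ′ y)) (∑-δ y (below f))

  above-antitone : ∀ g {x y} → x ≺ y → above g y ≤ above g x
  above-antitone g {x} {y} x≺y =
    ∑-mono λ z → *-monoʳ-≤ (g z) (ζ-≤ y z x z (≺-trans x≺y))

  below-monotone : ∀ f {x y} → x ≺ y → below f x ≤ below f y
  below-monotone f {x} {y} x≺y =
    ∑-mono λ z → *-monoʳ-≤ (f z) (ζ-≤ z x z y (λ z≺x → ≺-trans z≺x x≺y))

  -- Exchanging an inverted pair

  lower upper : (Fin card → Bool) → Weight
  lower b x = ⟦ b x ⟧
  upper b x = ⟦ not (b x) ⟧

  cutSize : (Fin card → Bool) → ℕ
  cutSize b = E (lower b) (upper b)

  -- Isolates what a single lower element `i` and a single upper element `j` contribute, so that the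
  -- cuts before and after an exchange can be compared term by term.
  expand : ∀ f i g j → E (f ⊕ δ′ i) (g ⊕ δ′ j) ≡ E f g + below f j + (above g i + ζ i j)
  expand f i g j = begin
    E (f ⊕ δ′ i) (g ⊕ δ′ j)
      ≡⟨ E-⊕ˡ f (δ′ i) (g ⊕ δ′ j) ⟩
    E f (g ⊕ δ′ j) + E (δ′ i) (g ⊕ δ′ j)
      ≡⟨ cong₂ _+_ (E-⊕ʳ f g (δ′ j)) (E-⊕ʳ (δ′ i) g (δ′ j)) ⟩
    E f g + E f (δ′ j) + (E (δ′ i) g + E (δ′ i) (δ′ j))
      ≡⟨ cong₂ _+_ (cong (E f g +_) (E-δʳ f j))
           (cong₂ _+_ (E-δˡ i g) (trans (E-δˡ i (δ′ j)) (∑-δ j (ζ i)))) ⟩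
    E f g + below f j + (above g i + ζ i j) ∎
    where open ≡-Reasoning

  swap : Fin card → Fin card → (Fin card → Bool) → Fin card → Bool
  swap x y b z = if does (x ≟ᶠ z) then true else if does (y ≟ᶠ z) then false else b z

  -- Let `C` and `D` be the two parts without `x` and `y`. By transitivity `y` has at least as many
  -- elements of `C` below it as `x`, and `x` at least as many elements of `D` above it as `y`. The
  -- pair `x ≺ y` itself supplies the strict gain.
  swap-improves : ∀ b {x y} → x ≺ y → b x ≡ false → b y ≡ true → cutSize b < cutSize (swap x y b)
  swap-improves b {x} {y} x≺y bx by = begin-strict
    cutSize b
      ≡⟨ E-cong lower-before upper-before ⟩
    E (C ⊕ δ′ y) (D ⊕ δ′ x)
      ≡⟨ expand C y D x ⟩
    E C D + below C x + (above D y + ζ y x)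
      ≡⟨ cong (λ k → E C D + below C x + (above D y + k)) (ζ-no (≺-asym x≺y)) ⟩
    E C D + below C x + (above D y + 0)
      ≤⟨ +-mono-≤ (+-monoʳ-≤ (E C D) (below-monotone C x≺y)) (+-monoˡ-≤ 0 (above-antitone D x≺y)) ⟩
    E C D + below C y + (above D x + 0)
      <⟨ +-monoʳ-< (E C D + below C y) (+-monoʳ-< (above D x) (n<1+n 0)) ⟩
    E C D + below C y + (above D x + 1)
      ≡⟨ cong (λ k → E C D + below C y + (above D x + k)) (ζ-yes x≺y) ⟨
    E C D + below C y + (above D x + ζ x y)
      ≡⟨ expand C x D y ⟨
    E (C ⊕ δ′ x) (D ⊕ δ′ y)
      ≡⟨ E-cong lower-after upper-after ⟨
    cutSize (swap x y b) ∎
    where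
    open ≤-Reasoning

    outside : Weight → Weight
    outside f z = if does (x ≟ᶠ z) then 0 else if does (y ≟ᶠ z) then 0 else f z

    C D : Weight
    C = outside (lower b)
    D = outside (upper b)

    x≢y : x ≢ y
    x≢y refl = ≺-irrefl refl x≺y

    lower-before : lower b ≗ C ⊕ δ′ y
    lower-before z with x ≟ᶠ z | y ≟ᶠ z
    ... | yes refl | yes y≡x  = contradiction (sym y≡x) x≢y
    ... | yes refl | no _     rewrite bx = refl
    ... | no _     | yes refl rewrite by = refl
    ... | no _     | no _     = sym (+-identityʳ _)

    upper-before : upper b ≗ D ⊕ δ′ x
    upper-before z with x ≟ᶠ z | y ≟ᶠ z
    ... | yes refl | yes y≡x  = contradiction (sym y≡x) x≢y
    ... | yes refl | no _     rewrite bx = refl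
    ... | no _     | yes refl rewrite by = refl
    ... | no _     | no _     = sym (+-identityʳ _)

    lower-after : lower (swap x y b) ≗ C ⊕ δ′ x
    lower-after z with x ≟ᶠ z | y ≟ᶠ z
    ... | yes _ | _     = refl
    ... | no _  | yes _ = refl
    ... | no _  | no _  = sym (+-identityʳ _)

    upper-after : upper (swap x y b) ≗ D ⊕ δ′ y
    upper-after z with x ≟ᶠ z | y ≟ᶠ z
    ... | yes refl | yes y≡x = contradiction (sym y≡x) x≢y
    ... | yes refl | no _    = refl
    ... | no _     | yes _   = refl
    ... | no _     | no _    = sym (+-identityʳ _)

  -- Phrased as the absence of an inverted pair, so that its failure provides the hypotheses of
  -- `swap-improves`.
  IsDownset : (Fin card → Bool) → Set
  IsDownset b = ∀ {x y} → x ≺ y → b x ≡ false → b y ≢ true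

  lower⊕upper : ∀ b → 𝟙 ≗ lower b ⊕ upper b
  lower⊕upper b x with b x
  ... | true  = refl
  ... | false = refl

  -- The formula e(B,U) = e(B,P) - e(P,B) with the subtraction moved across. Splitting `𝟙` into
  -- `lower b` and `upper b` on both sides leaves the common term e(B,B), and e(U,B) vanishes for a
  -- down-set.
  cutSize-downset : ∀ b → IsDownset b → cutSize b + E 𝟙 (lower b) ≡ E (lower b) 𝟙
  cutSize-downset b down = begin
    cutSize b + E 𝟙 β                ≡⟨ cong (cutSize b +_) (E-cong {g = β} {g′ = β} (lower⊕upper b) (λ _ → refl)) ⟩
    cutSize b + E (β ⊕ υ) β          ≡⟨ cong (cutSize b +_) (E-⊕ˡ β υ β) ⟩
    cutSize b + (E β β + E υ β)      ≡⟨ cong (λ k → cutSize b + (E β β + k)) no-inversions ⟩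
    cutSize b + (E β β + 0)          ≡⟨ rearrange (cutSize b) (E β β) ⟩
    E β β + cutSize b                ≡⟨ E-⊕ʳ β β υ ⟨
    E β (β ⊕ υ)                      ≡⟨ E-cong {β} {β} (λ _ → refl) (lower⊕upper b) ⟨
    E β 𝟙                            ∎
    where
    open ≡-Reasoning
    β = lower b
    υ = upper b

    rearrange : ∀ a b → a + (b + 0) ≡ b + a
    rearrange = solve-∀

    no-inversion : ∀ x y → υ x * (β y * ζ x y) ≡ 0
    no-inversion x y with b x in bx | b y in by
    ... | true  | _     = refl
    ... | false | false = refl
    ... | false | true  = cong (λ k → 1 * (1 * k)) (ζ-no λ x≺y → down x≺y bx by)

    no-inversions : E υ β ≡ 0
    no-inversions = trans
      (sum-cong-≗ λ x → trans (*-distribˡ-sum (υ x) λ y → β y * ζ x y)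
        (trans (sum-cong-≗ (no-inversion x)) (sum-replicate-zero card)))
      (sum-replicate-zero card)

  -- The optimal down-set

  up down : Weight
  up   = above 𝟙
  down = below 𝟙

  best : Fin card → Bool
  best x = down x <ᵇ up x

  -- If `x ≺ y` and `y` is chosen, then `down x ≤ down y < up y ≤ up x`, so `x` is chosen too.
  best-isDownset : IsDownset best
  best-isDownset {x} {y} x≺y bx by = contradiction
    (≤-<-trans (below-monotone 𝟙 x≺y) (<-≤-trans down<up (above-antitone 𝟙 x≺y)))
    (λ x-in → subst T bx (<⇒<ᵇ x-in))
    where
    down<up : down y < up y
    down<up = <ᵇ⇒< (down y) (up y) (subst T (sym by) _)

  -- States without subtraction that `best` maximises the sum of `up x − down x` over a subset. It
  -- holds element by element, since `best` selects exactly the positive terms; `b` is arbitrary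
  -- here.
  best-exchange : ∀ b → E (lower b) 𝟙 + E 𝟙 (lower best) ≤ E (lower best) 𝟙 + E 𝟙 (lower b)
  best-exchange b = begin
    E β 𝟙 + E 𝟙 β₀                                   ≡⟨ cong (E β 𝟙 +_) (E≡∑below 𝟙 β₀) ⟩
    (∑ λ x → β x * up x) + (∑ λ x → β₀ x * down x)   ≡⟨ ∑-distrib-+ (λ x → β x * up x) (λ x → β₀ x * down x) ⟨
    (∑ λ x → β x * up x + β₀ x * down x)             ≤⟨ ∑-mono pointwise ⟩
    (∑ λ x → β₀ x * up x + β x * down x)             ≡⟨ ∑-distrib-+ (λ x → β₀ x * up x) (λ x → β x * down x) ⟩
    (∑ λ x → β₀ x * up x) + (∑ λ x → β x * down x)   ≡⟨ cong (E β₀ 𝟙 +_) (E≡∑below 𝟙 β) ⟨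
    E β₀ 𝟙 + E 𝟙 β                                   ∎
    where
    open ≤-Reasoning
    β  = lower b
    β₀ = lower best

    pointwise : ∀ x → β x * up x + β₀ x * down x ≤ β₀ x * up x + β x * down x
    pointwise x with b x | best x in bx
    ... | true  | true  = ≤-refl
    ... | false | false = ≤-refl
    ... | false | true  = begin
      1 * down x          ≤⟨ *-monoʳ-≤ 1 (<⇒≤ (<ᵇ⇒< (down x) (up x) (subst T (sym bx) _))) ⟩
      1 * up x            ≡⟨ +-identityʳ (1 * up x) ⟨
      1 * up x + 0        ∎
    ... | true  | false = begin
      1 * up x + 0        ≡⟨ +-identityʳ (1 * up x) ⟩
      1 * up x            ≤⟨ *-monoʳ-≤ 1 (≮⇒≥ λ d<u → subst T bx (<⇒<ᵇ d<u)) ⟩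
      1 * down x          ∎

  -- Adding `E 𝟙 β + E 𝟙 β₀` to both sides makes `cutSize-downset` applicable to both cuts and
  -- leaves `best-exchange`.
  downset≤best : ∀ b → IsDownset b → cutSize b ≤ cutSize best
  downset≤best b isDown = +-cancelʳ-≤ (E 𝟙 β + E 𝟙 β₀) _ _ (begin
    cutSize b + (E 𝟙 β + E 𝟙 β₀)        ≡⟨ +-assoc (cutSize b) _ _ ⟨
    cutSize b + E 𝟙 β + E 𝟙 β₀          ≡⟨ cong (_+ E 𝟙 β₀) (cutSize-downset b isDown) ⟩
    E β 𝟙 + E 𝟙 β₀                      ≤⟨ best-exchange b ⟩
    E β₀ 𝟙 + E 𝟙 β                      ≡⟨ cong (_+ E 𝟙 β) (cutSize-downset best best-isDownset) ⟨
    cutSize best + E 𝟙 β₀ + E 𝟙 β       ≡⟨ rearrange (cutSize best) _ _ ⟩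
    cutSize best + (E 𝟙 β + E 𝟙 β₀)     ∎)
    where
    open ≤-Reasoning
    β  = lower b
    β₀ = lower best

    rearrange : ∀ a b c → a + b + c ≡ a + (c + b)
    rearrange = solve-∀

  -- From arbitrary cuts to down-sets

  cutSize≤total : ∀ b → cutSize b ≤ E 𝟙 𝟙
  cutSize≤total b = E-mono (λ x → ⟦⟧≤1 (b x)) (λ x → ⟦⟧≤1 (not (b x)))
    where
    ⟦⟧≤1 : ∀ a → ⟦ a ⟧ ≤ 1
    ⟦⟧≤1 true  = ≤-refl
    ⟦⟧≤1 false = z≤n

  -- Induction on `k`, which bounds the number of exchanges still possible: each one enlarges the
  -- cut, and no cut exceeds `E 𝟙 𝟙`. When no inverted pair is left, the cut is a down-set.
  best-largest-within : ∀ k b → E 𝟙 𝟙 ≤ k + cutSize b → cutSize b ≤ cutSize best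
  best-largest-within k b bound
    with any? (λ x → any? (λ y → (x ≺? y) ×-dec (b x ≟ᵇ false) ×-dec (b y ≟ᵇ true)))
  ... | no none = downset≤best b λ x≺y bx by → none (_ , _ , x≺y , bx , by)
  -- Here the cut already has size at least `E 𝟙 𝟙`, so a further exchange would exceed the total
  -- number of pairs.
  best-largest-within zero b bound | yes (x , y , x≺y , bx , by) =
    contradiction (≤-trans (cutSize≤total (swap x y b)) bound)
                  (<⇒≱ (swap-improves b x≺y bx by))
  best-largest-within (suc k) b bound | yes (x , y , x≺y , bx , by) =
    ≤-trans (<⇒≤ improved) (best-largest-within k (swap x y b) (begin
      E 𝟙 𝟙                           ≤⟨ bound ⟩
      suc k + cutSize b               ≡⟨ +-suc k (cutSize b) ⟨
      k + suc (cutSize b)             ≤⟨ +-monoʳ-≤ k improved ⟩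
      k + cutSize (swap x y b)        ∎))
    where
    open ≤-Reasoning
    improved = swap-improves b x≺y bx by

  best-largest : ∀ b → cutSize b ≤ cutSize best
  best-largest b = best-largest-within (E 𝟙 𝟙) b (m≤m+n (E 𝟙 𝟙) (cutSize b))

  -- Cuts as pairs of subsets

  e≡E : ∀ X Y → e P X Y ≡ E (lower (Vec.lookup X)) (lower (Vec.lookup Y))
  e≡E X Y = trans (length≡sum (filter in? pairs))
    (trans (sum-filter-pairs in? (λ _ → 1))
    (sum-cong-≗ λ x → trans (sum-cong-≗ (term x))
      (sym (*-distribˡ-sum (lower (Vec.lookup X) x) λ y → lower (Vec.lookup Y) y * ζ x y))))
    where
    pairs = cartesianProduct (allFin card) (allFin card)
    in? : Decidable _
    in? (x , y) = (x ∈? X) ×-dec (y ∈? Y) ×-dec (x ≺? y)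

    term : ∀ x y → ⟦ does (x ∈? X) ∧ does (y ∈? Y) ∧ does (x ≺? y) ⟧ * 1
                 ≡ ⟦ Vec.lookup X x ⟧ * (⟦ Vec.lookup Y y ⟧ * ζ x y)
    term x y rewrite does-∈? x X | does-∈? y Y = trans (*-identityʳ _)
      (trans (⟦⟧-∧ (Vec.lookup X x) _) (cong (⟦ Vec.lookup X x ⟧ *_) (⟦⟧-∧ (Vec.lookup Y y) _)))

  -- Covering and disjointness, read at each element, force `U` to be the complement of `B`, so the
  -- lower part determines the cut.
  e-cut : ∀ {B U} → IsCut P B U → e P B U ≡ cutSize (Vec.lookup B)
  e-cut {B} {U} isCut = trans (e≡E B U) (E-cong {lower (Vec.lookup B)} (λ _ → refl) λ x → cong ⟦_⟧ (complement x))
    where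
    open IsCut isCut
    complement : ∀ x → Vec.lookup U x ≡ not (Vec.lookup B x)
    complement x = exclusive (Vec.lookup B x) (Vec.lookup U x)
      (trans (sym (Vec.lookup-zipWith _∨_ x B U))
        (trans (cong (λ X → Vec.lookup X x) covers) (Vec.lookup-replicate x true)))
      (trans (sym (Vec.lookup-zipWith _∧_ x B U))
        (trans (cong (λ X → Vec.lookup X x) disjoint) (Vec.lookup-replicate x false)))
      where
      exclusive : ∀ a b → a ∨ b ≡ true → a ∧ b ≡ false → b ≡ not a
      exclusive true  false _ _ = refl
      exclusive false true  _ _ = refl

  complementary-isCut : ∀ b → IsCut P (Vec.tabulate b) (Vec.tabulate (not ∘ b))
  complementary-isCut b = record
    { covers   = pointwise _∨_ true  λ { true → refl ; false → refl }
    ; disjoint = pointwise _∧_ false λ { true → refl ; false → refl }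
    }
    where
    pointwise : ∀ _∙_ c → (∀ a → a ∙ not a ≡ c) →
                Vec.zipWith _∙_ (Vec.tabulate b) (Vec.tabulate (not ∘ b)) ≡ Vec.replicate card c
    pointwise _∙_ c law = trans (sym (Vec.tabulate∘lookup _))
      (trans (Vec.tabulate-cong λ x → trans (Vec.lookup-zipWith _∙_ x (Vec.tabulate b) (Vec.tabulate (not ∘ b)))
        (trans (cong₂ _∙_ (Vec.lookup∘tabulate b x) (Vec.lookup∘tabulate (not ∘ b) x))
          (trans (law (b x)) (sym (Vec.lookup-replicate x c)))))
      (Vec.tabulate∘lookup (Vec.replicate card c)))

  best-isLargestCut : IsLargestCut P (Vec.tabulate best) (Vec.tabulate (not ∘ best))
  best-isLargestCut = record
    { isCut   = complementary-isCut best
    ; largest = λ B′ U′ isCut′ → begin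
        e P B′ U′                                    ≡⟨ e-cut isCut′ ⟩
        cutSize (Vec.lookup B′)                      ≤⟨ best-largest (Vec.lookup B′) ⟩
        cutSize best                                 ≡⟨ E-cong (λ x → cong ⟦_⟧ (same x)) (λ x → cong (⟦_⟧ ∘ not) (same x)) ⟩
        cutSize (Vec.lookup (Vec.tabulate best))     ≡⟨ e-cut (complementary-isCut best) ⟨
        e P (Vec.tabulate best) (Vec.tabulate (not ∘ best)) ∎
    }
    where
    open ≤-Reasoning
    same : best ≗ Vec.lookup (Vec.tabulate best)
    same x = sym (Vec.lookup∘tabulate best x)

  -- From the input list to the order

  module _ {ps} (lists : ListsOrder P ps) where
    open ListsOrder lists

    -- Two lists without repetitions and with the same members are permutations of each other. Hence
    -- sums over the input do not depend on the order in which it lists the pairs.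
    ps↭ : ps ↭ filter (λ (x , y) → x ≺? y) (cartesianProduct (allFin card) (allFin card))
    ps↭ = ∼bag⇒↭ (unique∧set⇒bag unique
      (Unique.filter⁺ _ (Unique.cartesianProduct⁺ (Unique.allFin⁺ card) (Unique.allFin⁺ card)))
      (mk⇔
        (λ p∈ps → ∈-filter⁺ _ (∈-cartesianProduct⁺ (∈-allFin _) (∈-allFin _))
                    (Equivalence.to (exact _ _) p∈ps))
        (λ p∈ → Equivalence.from (exact _ _)
          (proj₂ (∈-filter⁻ _ {xs = cartesianProduct (allFin card) (allFin card)} p∈)))))

    sum-ps : ∀ h → sum (map h ps) ≡ ∑ λ x → ∑ λ y → ζ x y * h (x , y)
    sum-ps h = trans (sum-↭ (map⁺ h ps↭)) (sum-filter-pairs _ h)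

    -- Identifies the number of rounds of the loop over pairs with the second summand of `size`.
    length-ps : length ps ≡ e P ⊤ ⊤
    length-ps = begin
      length ps                                  ≡⟨ length≡sum ps ⟩
      sum (map (λ _ → 1) ps)                     ≡⟨ sum-ps (λ _ → 1) ⟩
      (∑ λ x → ∑ λ y → ζ x y * 1)                ≡⟨ sum-cong-≗ (λ x → trans (sum-cong-≗ λ y → *-comm (ζ x y) 1) (sym (*-identityˡ _))) ⟩
      E 𝟙 𝟙                                      ≡⟨ E-cong full full ⟩
      E (lower (Vec.lookup ⊤)) (lower (Vec.lookup ⊤)) ≡⟨ e≡E ⊤ ⊤ ⟨
      e P ⊤ ⊤ ∎
      where
      open ≡-Reasoning
      full : 𝟙 ≗ lower (Vec.lookup ⊤)
      full x = cong ⟦_⟧ (sym (Vec.lookup-replicate x true))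

    -- The pairs with first component `z` correspond to the elements above `z`.
    sum-δ-proj₁ : ∀ z → sum (map (δ′ z ∘ proj₁) ps) ≡ up z
    sum-δ-proj₁ z = begin
      sum (map (δ′ z ∘ proj₁) ps)           ≡⟨ sum-ps (δ′ z ∘ proj₁) ⟩
      (∑ λ x → ∑ λ y → ζ x y * δ′ z x)      ≡⟨ sum-cong-≗ (λ x → sum-cong-≗ λ y → reorder (ζ x y) (δ′ z x)) ⟩
      (∑ λ x → ∑ λ y → δ′ z x * (1 * ζ x y)) ≡⟨ sum-cong-≗ (λ x → *-distribˡ-sum (δ′ z x) (λ y → 1 * ζ x y)) ⟨
      E (δ′ z) 𝟙                            ≡⟨ E-δˡ z 𝟙 ⟩
      up z                                  ∎
      where
      open ≡-Reasoning
      reorder : ∀ a b → a * b ≡ b * (1 * a)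
      reorder = solve-∀

    sum-δ-proj₂ : ∀ z → sum (map (δ′ z ∘ proj₂) ps) ≡ down z
    sum-δ-proj₂ z = begin
      sum (map (δ′ z ∘ proj₂) ps)           ≡⟨ sum-ps (δ′ z ∘ proj₂) ⟩
      (∑ λ x → ∑ λ y → ζ x y * δ′ z y)      ≡⟨ sum-cong-≗ (λ x → sum-cong-≗ λ y → *-comm (ζ x y) (δ′ z y)) ⟩
      (∑ λ x → above (δ′ z) x)              ≡⟨ sum-cong-≗ (λ x → *-identityˡ (above (δ′ z) x)) ⟨
      E 𝟙 (δ′ z)                            ≡⟨ E-δʳ 𝟙 z ⟩
      down z                                ∎
      where open ≡-Reasoning

    module _ (name : Fin card → ℕ) (injective : Injective _≡_ _≡_ name) where

      -- Injectivity enters here: the machine compares names, and equal names must mean equal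
      -- elements.
      δ-name : ∀ x y → δ (name x) (name y) ≡ δ′ x y
      δ-name x y with x ≟ᶠ y
      ... | yes refl = δ-refl (name x)
      ... | no  x≢y  = δ-≢ (name x) (name y) (x≢y ∘ injective)

      tally-name : ∀ (end : Fin card × Fin card → Fin card) x →
                   tally (name x) (map (name ∘ end) ps) ≡ sum (map (δ′ x ∘ end) ps)
      tally-name end x = cong sum (trans (sym (map-∘ ps)) (map-cong (δ-name x ∘ end) ps))

      bit-name : ∀ x → bit (tally (name x) (map (name ∘ proj₁) ps)) (tally (name x) (map (name ∘ proj₂) ps))
                       ≡ ⟦ best x ⟧
      bit-name x = trans
        (cong₂ bit (trans (tally-name proj₁ x) (sum-δ-proj₁ x))
                   (trans (tally-name proj₂ x) (sum-δ-proj₂ x)))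
        (bit≡⟦<ᵇ⟧ (up x) (down x))

      output-encodes-best :
        map (λ v → bit (tally v (map (name ∘ proj₁) ps)) (tally v (map (name ∘ proj₂) ps)))
            (map name (allFin card))
          ≡ encodeCut P (Vec.tabulate best)
      output-encodes-best = begin
        map _ (map name (allFin card))         ≡⟨ map-∘ (allFin card) ⟨
        map _ (allFin card)                    ≡⟨ map-cong bit-name (allFin card) ⟩
        map (⟦_⟧ ∘ best) (allFin card)         ≡⟨ map-tabulate id (⟦_⟧ ∘ best) ⟩
        tabulate (⟦_⟧ ∘ best)                  ≡⟨ map-tabulate best ⟦_⟧ ⟨
        map ⟦_⟧ (tabulate best)                ≡⟨ cong (map ⟦_⟧) (toList-tabulate best) ⟨
        encodeCut P (Vec.tabulate best)        ∎
        where open ≡-Reasoning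

      prog-prints-best : prog ⊢ initial (encodeInput P name ps)
                              ↝[ runtime card (length ps) ] encodeCut P (Vec.tabulate best)
      prog-prints-best =
        subst₂ (λ n → prog ⊢ initial (n ∷ names ++ length ps ∷ encodePairs name ps)
                           ↝[ runtime n (length ps) ]_)
               (trans (length-map name (allFin card)) (length-tabulate id)) output-encodes-best
               (prog-runs name names ps)
        where names = map name (allFin card)

runtime-linear : ∀ n m → runtime n m ≤ 31 * (n + m) + 10
-- The exact count is `31 * n + 21 * m + 10`, where 31 is 10 for storing a name plus 21 for printing
-- its bit. Adding `10 * m` equalises the two coefficients.
runtime-linear n m = subst (runtime n m ≤_) (slack n m) (m≤m+n (runtime n m) (10 * m))
  where
  slack : ∀ n m → 3 + (n * 10 + 1 + (1 + (m * 21 + 1 + (2 + (n * 21 + 2))))) + 10 * m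
                ≡ 31 * (n + m) + 10
  slack = solve-∀

mainTheorem2 : ∃[ prog ] ∃[ a ] ∃[ b ]
    ((P : FinPoset) → let open FinPoset P in
    (name : Fin card → ℕ) → Injective _≡_ _≡_ name →
    (ps : List (Fin card × Fin card)) → ListsOrder P ps →
    ∃[ t ] ∃[ B ] ∃[ U ]
    ( prog ⊢ initial (encodeInput P name ps) ↝[ t ] encodeCut P B
    × t ≤ a * size P + b
    × IsLargestCut P B U ))
mainTheorem2 = prog , 31 , 10 , λ P name injective ps lists →
    runtime (FinPoset.card P) (length ps) , _ , _
  , prog-prints-best P lists name injective
  , subst (λ m → runtime (FinPoset.card P) (length ps) ≤ 31 * (FinPoset.card P + m) + 10)
      (length-ps P lists) (runtime-linear (FinPoset.card P) (length ps))
  , best-isLargestCut P
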